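{- Let $k$ be a positive integer and let $G$ and $H$ be finite simple undirected graphs. Then $$\gamma_{\{k\}}(G)\,\gamma_{\{k\}}(H) \leq 2k\,\gamma_{\{k\}}(G \Box H).$$
   Context: All graphs are finite, simple and undirected; all multisets are finite. For a vertex $v$ of a graph $G$, $N_G[v]$ denotes the closed neighborhood of $v$ (the neighbors of $v$ together with $v$ itself). The cardinality of a multiset counts elements with multiplicity. A $\{k\}$-dominating multiset of a graph $G$ is a multiset $D_k$ of vertices of $G$ such that, for each $v \in V(G)$, the number of vertices of $N_G[v]$ contained in $D_k$, counted with multiplicity, is at least $k$. The minimum cardinality of a $\{k\}$-dominating multiset of $G$ is denoted $\gamma_{\{k\}}(G)$. The Cartesian product $G \Box H$ is the graph with vertex set $V(G)\times V(H)$, in which $gh$ and $g'h'$ are adjacent whenever $g=g'$ and $(h,h')\in E(H)$, or $h=h'$ and $(g,g')\in E(G)$. -}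

module Defs where

import Algebra.Properties.CommutativeMonoid.Sum
open import Data.Bool.Base using (if_then_else_; true; false)
open import Data.Fin.Base using (Fin; zero; suc; toℕ; fromℕ<; funToFin; finToFun)
open import Data.Fin.Properties using (inj⇒≟; *↔×; all?; any?; toℕ-fromℕ<; finToFun-funToFin)
open import Data.Nat.Base using (ℕ; _*_; _^_; _≤_; _≥_; _<_)
open import Data.Nat.Induction using (<-wellFounded)
open import Data.Nat.Properties
  using (+-0-commutativeMonoid; _≤?_; _<?_; ≤-trans; ≤-reflexive; ≤-<-trans;
         m≤m+n; m≤n+m; ≮⇒≥)
open import Data.Product.Base using (∃-syntax; _×_; _,_; proj₁; proj₂)
open import Data.Product.Function.NonDependent.Propositional using (_×-↔_)
open import Data.Sum.Base using (_⊎_; inj₁; inj₂)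
import Data.Sum.Base as Sum
open import Data.Vec.Functional using (Vector)
open import Function.Base using (_∘_; const)
open import Function.Bundles using (_↔_; Inverse)
open import Function.Properties.Inverse using (↔-trans; ↔-sym; ↔⇒↣)
open import Induction.WellFounded using (Acc; acc)
open import Level using (0ℓ)
open import Relation.Binary.Core using (Rel)
open import Relation.Binary.Definitions
  using (Decidable; DecidableEquality; Symmetric; Irreflexive)
open import Relation.Binary.PropositionalEquality
  using (_≡_; refl; sym; trans; cong; subst; _≗_)
open import Relation.Nullary.Decidable
  using (Dec; yes; no; does; map′; _×-dec_; _⊎-dec_; dec-true)
open import Relation.Nullary.Negation using (contradiction)
open import Relation.Unary using (Pred)
import Relation.Unary as Unary

open Algebra.Properties.CommutativeMonoid.Sum +-0-commutativeMonoid public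
  using (sum; sum-cong-≗)

-- Finite simple undirected graphs.  The set of vertices may be any type
-- with finitely many elements, so that a product graph can literally have
-- pairs as vertices.

record Graph : Set₁ where
  field
    Vertex : Set
    order  : ℕ
    enum   : Vertex ↔ Fin order
    Adj    : Rel Vertex 0ℓ
    adj?   : Decidable Adj
    symm   : Symmetric Adj
    irrefl : Irreflexive _≡_ Adj

  index : Vertex → Fin order
  index = Inverse.to enum

  vertex : Fin order → Vertex
  vertex = Inverse.from enum

  vertex-index : ∀ v → vertex (index v) ≡ v
  vertex-index v = Inverse.strictlyInverseʳ enum v

  _≟_ : DecidableEquality Vertex
  _≟_ = inj⇒≟ (↔⇒↣ enum)

  N[_] : Vertex → Pred Vertex 0ℓ
  N[ v ] w = Adj v w ⊎ w ≡ v

  N[_]? : ∀ v → Unary.Decidable N[ v ]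
  N[ v ]? w = adj? v w ⊎-dec w ≟ v

infixr 7 _□_

_□_ : Graph → Graph → Graph
G □ H = record
  { Vertex = G.Vertex × H.Vertex
  ; order  = G.order * H.order
  ; enum   = ↔-trans (G.enum ×-↔ H.enum) (↔-sym *↔×)
  ; Adj    = λ (g , h) (g′ , h′) → (g ≡ g′ × H.Adj h h′) ⊎ (h ≡ h′ × G.Adj g g′)
  ; adj?   = λ (g , h) (g′ , h′) →
               (g G.≟ g′ ×-dec H.adj? h h′) ⊎-dec (h H.≟ h′ ×-dec G.adj? g g′)
  ; symm   = Sum.map (λ (e , a) → sym e , H.symm a) (λ (e , a) → sym e , G.symm a)
  ; irrefl = λ { refl (inj₁ (_ , a)) → H.irrefl refl a
               ; refl (inj₂ (_ , a)) → G.irrefl refl a }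
  }
  where
  module G = Graph G
  module H = Graph H

module _ (G : Graph) where
  open Graph G

  -- A multiset of vertices is given by its multiplicity function; it is
  -- automatically finite because there are finitely many vertices.
  Multiset : Set
  Multiset = Vertex → ℕ

  card : Multiset → ℕ
  card D = sum (λ i → D (vertex i))

  -- The part of a multiset lying in a decidable set of vertices.
  restrict : {P : Pred Vertex 0ℓ} → Unary.Decidable P → Multiset → Multiset
  restrict P? D w = if does (P? w) then D w else 0

  Dominating : ℕ → Multiset → Set
  Dominating k D = ∀ v → card (restrict N[ v ]? D) ≥ k

  IsDominationNumber : ℕ → ℕ → Set
  IsDominationNumber k m =
    (∃[ D ] (Dominating k D × card D ≡ m)) ×
    (∀ D → Dominating k D → m ≤ card D)

-- Every graph has a {k}-domination number: starting from the dominating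
-- multiset that contains each vertex k times, descend as long as there is a
-- strictly smaller one.  This is decidable, since the multiplicities in a
-- multiset of cardinality less than c are less than c.

term≤sum : ∀ {n} (t : Vector ℕ n) i → t i ≤ sum t
term≤sum t zero    = m≤m+n _ _
term≤sum t (suc i) = ≤-trans (term≤sum (t ∘ suc) i) (m≤n+m _ (t zero))

module _ (G : Graph) where
  open Graph G

  mult≤card : ∀ D v → D v ≤ card G D
  mult≤card D v = subst (λ w → D w ≤ card G D) (vertex-index v)
                    (term≤sum (D ∘ vertex) (index v))

  card-cong : ∀ {D E : Multiset G} → D ≗ E → card G D ≡ card G E
  card-cong D≗E = sum-cong-≗ (D≗E ∘ vertex)

  restrict-cong : ∀ {P : Pred Vertex 0ℓ} (P? : Unary.Decidable P) {D E : Multiset G} →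
                  D ≗ E → restrict G P? D ≗ restrict G P? E
  restrict-cong P? D≗E w with does (P? w)
  ... | true  = D≗E w
  ... | false = refl

  dominating-cong : ∀ {k} {D E : Multiset G} → D ≗ E → Dominating G k D → Dominating G k E
  dominating-cong D≗E dom v =
    ≤-trans (dom v) (≤-reflexive (card-cong (restrict-cong N[ v ]? D≗E)))

  dominating-const : ∀ k → Dominating G k (const k)
  dominating-const k v = ≤-trans (≤-reflexive (sym at-v)) (mult≤card (restrict G N[ v ]? (const k)) v)
    where
    at-v : restrict G N[ v ]? (const k) v ≡ k
    at-v = cong (if_then k else 0) (dec-true (N[ v ]? v) (inj₂ refl))

  dominating? : ∀ k → Unary.Decidable (Dominating G k)
  dominating? k D = map′
    (λ f v → subst (λ w → card G (restrict G N[ w ]? D) ≥ k) (vertex-index v) (f (index v)))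
    (λ dom i → dom (vertex i))
    (all? (λ i → k ≤? card G (restrict G N[ vertex i ]? D)))

  smaller? : ∀ k c → Dec (∃[ D ] (Dominating G k D × card G D < c))
  smaller? k c = map′
    (λ (x , p) → decode x , p)
    (λ (D , dom , D<c) →
      let D< : ∀ v → D v < c
          D< v = ≤-<-trans (mult≤card D v) D<c
          x    = funToFin (λ i → fromℕ< (D< (vertex i)))
          D≗   : D ≗ decode x
          D≗ v = sym (trans (cong toℕ (finToFun-funToFin _ (index v)))
                     (trans (toℕ-fromℕ< _) (cong D (vertex-index v))))
      in x , dominating-cong D≗ dom , subst (_< c) (card-cong D≗) D<c)
    (any? (λ x → dominating? k (decode x) ×-dec card G (decode x) <? c))
    where
    decode : Fin (c ^ order) → Multiset G
    decode x v = toℕ (finToFun x (index v))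

  dominationNumber : ∀ k → ∃[ m ] IsDominationNumber G k m
  dominationNumber k = descend (const k) (dominating-const k) (<-wellFounded _)
    where
    descend : ∀ D → Dominating G k D → Acc _<_ (card G D) → ∃[ m ] IsDominationNumber G k m
    descend D dom (acc rec) with smaller? k (card G D)
    ... | yes (E , domE , E<D) = descend E domE (rec E<D)
    ... | no ∄smaller = card G D , (D , dom , refl) ,
                        λ E domE → ≮⇒≥ (λ E<D → ∄smaller (E , domE , E<D))

γ : ℕ → Graph → ℕ
γ k G = proj₁ (dominationNumber G k)

γ-isDominationNumber : ∀ k G → IsDominationNumber G k (γ k G)
γ-isDominationNumber k G = proj₂ (dominationNumber G k)

{-# OPTIONS --safe #-}

-- The Clark–Suen double count.  Let the elements of a minimum {k}-dominating
-- multiset of G be indexed, let every vertex g choose k indices s_g(j) of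
-- elements dominating it, and let F be a {k}-dominating multiset of G □ H.
-- Fix h.  If (g , h) is dominated x_g times along H, then it is dominated at
-- least k − x_g times along G, by the row of F at h.  For every t < k, keep
-- those s_g(j) for which the entry (j , t) of a k × k circulant with k ⊓ x_g
-- ones in every row and column is one, and remove the other indices.  Each
-- column leaves g with k ⊓ x_g of its indices, so the kept elements and the
-- row of F together {k}-dominate G; by minimality at most as many indices are
-- removed as the row has elements.  By the rows of the circulants, i is kept
-- for at most as many t as the sum of x_g over the choices s_g(j) = i.  So the
-- projection to H of F over the vertices choosing i, together with each h once
-- for every t that removes i, {k}-dominates H.  Summed over i, either part has
-- at most k |F| elements.

module Submission where

open import Defs
open import Data.Nat.Base using (ℕ; _*_; _≤_; NonZero)
open import Data.Nat.Base using (zero; suc; _+_; _∸_; _⊓_; _<ᵇ_; z≤n; s≤s)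
open import Data.Nat.DivMod using (_%_; [m+n]%n≡m%n; m<n⇒m%n≡m)
open import Data.Nat.Properties hiding (_≟_)
open import Algebra.Properties.Semiring.Sum +-*-semiring
  using (sum-init-last; ∑-distrib-+; ∑-comm; *-distribˡ-sum)
open import Data.Bool.Base using (if_then_else_; true; false)
open import Data.Fin.Base
  using (Fin; zero; suc; toℕ; fromℕ; inject₁; inject≤; combine; _↑ˡ_; _↑ʳ_)
open import Data.Fin.Properties using (_≟_; toℕ-fromℕ; toℕ-inject₁; toℕ<n; remQuot-combine)
open import Data.Product.Base using (_×_; _,_; proj₁; proj₂)
open import Data.Sum.Base using (inj₁; inj₂)
open import Data.Vec.Functional using (Vector; _∷_)
open import Function.Base using (_∘_; const)
open import Function.Bundles using (Inverse; Injection)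
open import Function.Properties.Inverse using (↔-sym; ↔⇒↣)
open import Relation.Binary.PropositionalEquality
  using (_≡_; refl; sym; trans; cong; cong₂; subst; module ≡-Reasoning)
open import Relation.Nullary.Decidable using (Dec; yes; no; does; dec-true)

private
  variable
    m n p q k : ℕ

-- Finite sums and push-forwards of weights.

∑-syntax : ∀ n → Vector ℕ n → ℕ
∑-syntax n = sum

infixr 6.5 ∑-syntax
syntax ∑-syntax n (λ i → x) = ∑[ i < n ] x

sum-mono : {f g : Vector ℕ n} → (∀ i → f i ≤ g i) → sum f ≤ sum g
sum-mono {zero}  f≤g = z≤n
sum-mono {suc n} f≤g = +-mono-≤ (f≤g zero) (sum-mono (f≤g ∘ suc))

sum-const : ∀ n c → sum {n} (const c) ≡ n * c
sum-const zero    c = refl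
sum-const (suc n) c = cong (c +_) (sum-const n c)

sum-inject≤ : (f : Vector ℕ n) (m≤n : m ≤ n) → ∑[ i < m ] f (inject≤ i m≤n) ≤ sum f
sum-inject≤ {m = zero}              f m≤n       = z≤n
sum-inject≤ {n = suc n} {m = suc m} f (s≤s m≤n) = +-monoʳ-≤ (f zero) (sum-inject≤ (f ∘ suc) m≤n)

sum-split : ∀ m (f : Vector ℕ (m + n)) →
  sum f ≡ ∑[ i < m ] f (i ↑ˡ n) + ∑[ j < n ] f (m ↑ʳ j)
sum-split zero    f = refl
sum-split (suc m) f = trans (cong (f zero +_) (sum-split m (f ∘ suc))) (sym (+-assoc (f zero) _ _))

sum-combine : ∀ m (f : Vector ℕ (m * n)) → sum f ≡ ∑[ i < m ] ∑[ j < n ] f (combine i j)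
sum-combine         zero    f = refl
sum-combine {n = n} (suc m) f =
  trans (sum-split n f) (cong (∑[ j < n ] f (j ↑ˡ (m * n)) +_) (sum-combine m (f ∘ (n ↑ʳ_))))

sum-*-if : (w : Vector ℕ n) (x : Fin n) (c : ℕ) →
  ∑[ i < n ] w i * (if does (x ≟ i) then c else 0) ≡ w x * c
sum-*-if {suc n} w zero c = begin
  w zero * c + ∑[ i < n ] w (suc i) * 0  ≡⟨ cong (w zero * c +_) (sum-cong-≗ (λ i → *-zeroʳ (w (suc i)))) ⟩
  w zero * c + sum {n} (const 0)         ≡⟨ cong (w zero * c +_) (trans (sum-const n 0) (*-zeroʳ n)) ⟩
  w zero * c + 0                         ≡⟨ +-identityʳ _ ⟩
  w zero * c                             ∎
  where open ≡-Reasoning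
sum-*-if {suc n} w (suc x) c = cong₂ _+_ (*-zeroʳ (w zero)) (sum-*-if (w ∘ suc) x c)

-- The push-forward of the weight `φ` along `s`, as for measures.
push : (Fin p → Fin q) → Vector ℕ p → Vector ℕ q
push {p} s φ i = ∑[ j < p ] (if does (s j ≟ i) then φ j else 0)

-- Change of variables: once the two sums are swapped, each `j` contributes only at `i = s j`.
sum-*-push : (w : Vector ℕ q) (s : Fin p → Fin q) (φ : Vector ℕ p) →
  ∑[ i < q ] w i * push s φ i ≡ ∑[ j < p ] w (s j) * φ j
sum-*-push {q} {p} w s φ = begin
  ∑[ i < q ] w i * push s φ i
    ≡⟨ sum-cong-≗ (λ i → *-distribˡ-sum (w i) (λ j → if does (s j ≟ i) then φ j else 0)) ⟩
  ∑[ i < q ] ∑[ j < p ] w i * (if does (s j ≟ i) then φ j else 0)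
    ≡⟨ ∑-comm (λ i j → w i * (if does (s j ≟ i) then φ j else 0)) ⟩
  ∑[ j < p ] ∑[ i < q ] w i * (if does (s j ≟ i) then φ j else 0)
    ≡⟨ sum-cong-≗ (λ j → sum-*-if w (s j) (φ j)) ⟩
  ∑[ j < p ] w (s j) * φ j ∎
  where open ≡-Reasoning

sum-push : (s : Fin p → Fin q) (φ : Vector ℕ p) → sum (push s φ) ≡ sum φ
sum-push s φ = begin
  sum (push s φ)                ≡⟨ sum-cong-≗ (λ i → *-identityˡ (push s φ i)) ⟨
  sum (λ i → 1 * push s φ i)    ≡⟨ sum-*-push (const 1) s φ ⟩
  sum (λ j → 1 * φ j)           ≡⟨ sum-cong-≗ (λ j → *-identityˡ (φ j)) ⟩
  sum φ                         ∎
  where open ≡-Reasoning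

≤-push : (s : Fin p → Fin q) (φ : Vector ℕ p) (j : Fin p) → φ j ≤ push s φ (s j)
≤-push s φ j = begin
  φ j                                           ≡⟨ cong (if_then φ j else 0) (dec-true (s j ≟ s j) refl) ⟨
  (if does (s j ≟ s j) then φ j else 0)         ≤⟨ term≤sum (λ j′ → if does (s j′ ≟ s j) then φ j′ else 0) j ⟩
  push s φ (s j)                                ∎
  where open ≤-Reasoning

-- Push-forward is additive in the weight, so the weights `φ t` may be added up at each `j` before
-- they are pushed.
sum-push-mono : (s : Fin p → Fin q) (φ : Fin m → Vector ℕ p) (c : ℕ) → (∀ j → ∑[ t < m ] φ t j ≤ c) →
  ∀ i → ∑[ t < m ] push s (φ t) i ≤ push s (const c) i
sum-push-mono {p = p} {m = m} s φ c φ≤c i = begin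
  ∑[ t < m ] push s (φ t) i
    ≡⟨ ∑-comm (λ t j → if does (s j ≟ i) then φ t j else 0) ⟩
  ∑[ j < p ] ∑[ t < m ] (if does (s j ≟ i) then φ t j else 0)
    ≤⟨ sum-mono (λ j → bound (does (s j ≟ i)) j) ⟩
  push s (const c) i ∎
  where
  open ≤-Reasoning
  bound : ∀ b j → ∑[ t < m ] (if b then φ t j else 0) ≤ (if b then c else 0)
  bound true  j = φ≤c j
  bound false j = ≤-reflexive (trans (sum-const m 0) (*-zeroʳ m))

-- Multisets listed as indexed families.

repeat : ∀ {A : Set} a → A → (Fin n → A) → Fin (a + n) → A
repeat zero    x u = u
repeat (suc a) x u = x ∷ repeat a x u

sum-repeat : ∀ {A : Set} (f : A → ℕ) a x (u : Fin n → A) →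
  sum (f ∘ repeat a x u) ≡ a * f x + sum (f ∘ u)
sum-repeat f zero    x u = refl
sum-repeat f (suc a) x u = trans (cong (f x +_) (sum-repeat f a x u)) (sym (+-assoc (f x) _ _))

elements : (U : Vector ℕ n) → Fin (sum U) → Fin n
elements {suc n} U = repeat (U zero) zero (suc ∘ elements (U ∘ suc))

sum-elements : (U f : Vector ℕ n) → sum (f ∘ elements U) ≡ ∑[ v < n ] U v * f v
sum-elements {zero}  U f = refl
sum-elements {suc n} U f = trans
  (sum-repeat f (U zero) zero (suc ∘ elements (U ∘ suc)))
  (cong (U zero * f zero +_) (sum-elements (U ∘ suc) (f ∘ suc)))

choose : (U : Vector ℕ n) → k ≤ sum U → Fin k → Fin n
choose U k≤U j = elements U (inject≤ j k≤U)

-- Dropping all but the first `k` listed elements only lowers the sum. Since `f` is arbitrary, this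
-- says that no element is chosen more often than its multiplicity.
sum-choose : (U : Vector ℕ n) (k≤U : k ≤ sum U) (f : Vector ℕ n) →
  sum (f ∘ choose U k≤U) ≤ ∑[ v < n ] U v * f v
sum-choose U k≤U f = ≤-trans (sum-inject≤ (f ∘ elements U) k≤U) (≤-reflexive (sum-elements U f))

-- Circulant 0-1 matrices.

sum-last : ∀ k (f : ℕ → ℕ) → f 0 + ∑[ i < k ] f (suc (toℕ i)) ≡ ∑[ i < k ] f (toℕ i) + f k
sum-last k f = begin
  sum t                                  ≡⟨ sum-init-last t ⟩
  ∑[ i < k ] t (inject₁ i) + t (fromℕ k)
    ≡⟨ cong₂ _+_ (sum-cong-≗ {k} (λ i → cong f (toℕ-inject₁ i))) (cong f (toℕ-fromℕ k)) ⟩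
  ∑[ i < k ] f (toℕ i) + f k             ∎
  where
  open ≡-Reasoning
  t : Vector ℕ (suc k)
  t = f ∘ toℕ

-- Shifting a window of length `k` by one drops `f c` and gains `f (c + k)`, which are equal.
sum-periodic : ∀ k (f : ℕ → ℕ) → (∀ i → f (i + k) ≡ f i) →
  ∀ c → ∑[ i < k ] f (c + toℕ i) ≡ ∑[ i < k ] f (toℕ i)
sum-periodic k f per zero    = refl
sum-periodic k f per (suc c) = trans
  (+-cancelˡ-≡ (f (c + 0)) _ _ (begin
    f (c + 0) + ∑[ i < k ] f (suc (c + toℕ i))
      ≡⟨ cong (f (c + 0) +_) (sum-cong-≗ {k} (λ i → cong f (+-suc c (toℕ i)))) ⟨
    f (c + 0) + ∑[ i < k ] f (c + suc (toℕ i))  ≡⟨ sum-last k (λ i → f (c + i)) ⟩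
    ∑[ i < k ] f (c + toℕ i) + f (c + k)        ≡⟨ +-comm _ (f (c + k)) ⟩
    f (c + k) + ∑[ i < k ] f (c + toℕ i)        ≡⟨ cong₂ _+_ (trans (per c) (cong f (sym (+-identityʳ c)))) refl ⟩
    f (c + 0) + ∑[ i < k ] f (c + toℕ i)        ∎))
  (sum-periodic k f per c)
  where open ≡-Reasoning

[_<_] : ℕ → ℕ → ℕ
[ i < x ] = if i <ᵇ x then 1 else 0

[<]≤1 : ∀ i x → [ i < x ] ≤ 1
[<]≤1 i x with i <ᵇ x
... | true  = ≤-refl
... | false = z≤n

sum-[<] : ∀ k x → ∑[ i < k ] [ toℕ i < x ] ≡ k ⊓ x
sum-[<] zero    x       = refl
sum-[<] (suc k) zero    = trans (sum-const k 0) (*-zeroʳ k)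
sum-[<] (suc k) (suc x) = cong suc (sum-[<] k x)

-- Every row is a cyclic shift of `k ⊓ x` ones followed by zeros. Using `j + t` instead of a
-- difference makes the matrix symmetric, so column sums follow from row sums.
circ : ∀ k .{{_ : NonZero k}} → ℕ → Fin k → Fin k → ℕ
circ k x j t = [ (toℕ j + toℕ t) % k < x ]

sum-circʳ : ∀ k .{{_ : NonZero k}} x j → ∑[ t < k ] circ k x j t ≡ k ⊓ x
sum-circʳ k x j = begin
  ∑[ t < k ] [ (toℕ j + toℕ t) % k < x ]
    ≡⟨ sum-periodic k (λ i → [ i % k < x ]) (λ i → cong [_< x ] ([m+n]%n≡m%n i k)) (toℕ j) ⟩
  ∑[ t < k ] [ toℕ t % k < x ]
    ≡⟨ sum-cong-≗ {k} (λ t → cong [_< x ] (m<n⇒m%n≡m (toℕ<n t))) ⟩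
  ∑[ t < k ] [ toℕ t < x ]
    ≡⟨ sum-[<] k x ⟩
  k ⊓ x ∎
  where open ≡-Reasoning

sum-circˡ : ∀ k .{{_ : NonZero k}} x t → ∑[ j < k ] circ k x j t ≡ k ⊓ x
sum-circˡ k x t = trans
  (sum-cong-≗ {k} (λ j → cong (λ i → [ i % k < x ]) (+-comm (toℕ j) (toℕ t))))
  (sum-circʳ k x t)

-- Weighted domination and the exchange in one row.

-- Domination with respect to a matrix of weights, in place of the 0-1
-- matrix of closed neighbourhoods.
Dominates : (Fin n → Fin n → ℕ) → ℕ → Vector ℕ n → Set
Dominates {n} a k D = ∀ v → k ≤ ∑[ w < n ] a v w * D w

Minimum : (Fin n → Fin n → ℕ) → ℕ → ℕ → Set
Minimum a k m = ∀ D → Dominates a k D → m ≤ sum D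

module Exchange
  (k : ℕ) .{{_ : NonZero k}} (a : Fin n → Fin n → ℕ) (min : Minimum a k m)
  (u : Fin m → Fin n) (s : Fin n → Fin k → Fin m)
  (s-≤ : ∀ g f → sum (f ∘ s g) ≤ ∑[ i < m ] a g (u i) * f i)
  (x y : Vector ℕ n) (k≤ : ∀ g → k ≤ ∑[ v < n ] a g v * y v + x g)
  where

  -- `covered t i` counts the ones in column `t` that belong to choices of `i`. The other two are
  -- complementary indicators: whether that count is positive or zero.
  covered kept removed : Fin k → Vector ℕ m
  covered t i = ∑[ g < n ] push (s g) (λ j → circ k (x g) j t) i
  kept    t i = covered t i ⊓ 1
  removed t i = 1 ∸ covered t i

  kept+removed : ∀ t i → kept t i + removed t i ≡ 1
  kept+removed t i = m⊓n+n∸m≡n (covered t i) 1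

  circ≤kept : ∀ g j t → circ k (x g) j t ≤ kept t (s g j)
  circ≤kept g j t = ⊓-glb
    (≤-trans (≤-push (s g) (λ j → circ k (x g) j t) j)
             (term≤sum (λ g′ → push (s g′) (λ j → circ k (x g′) j t) (s g j)) g))
    ([<]≤1 ((toℕ j + toℕ t) % k) (x g))

  -- Column `t` of the circulant of `g` has `k ⊓ x g` ones, and each of them marks a choice of `g`
  -- that is kept.
  kept-dominates : ∀ t → Dominates a k (λ v → y v + push u (kept t) v)
  kept-dominates t g = begin
    -- Truncating `x g` at `k` is harmless: if it exceeds `k`, the choices alone suffice.
    k                                              ≤⟨ ⊓-glb (m≤n+m k Y) (k≤ g) ⟩
    (Y + k) ⊓ (Y + x g)                            ≡⟨ +-distribˡ-⊓ Y k (x g) ⟨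
    Y + k ⊓ x g                                    ≡⟨ cong (Y +_) (sum-circˡ k (x g) t) ⟨
    Y + ∑[ j < k ] circ k (x g) j t                ≤⟨ +-monoʳ-≤ Y (sum-mono (λ j → circ≤kept g j t)) ⟩
    Y + ∑[ j < k ] kept t (s g j)                  ≤⟨ +-monoʳ-≤ Y (s-≤ g (kept t)) ⟩
    Y + ∑[ i < m ] a g (u i) * kept t i            ≡⟨ cong (Y +_) (sum-*-push (a g) u (kept t)) ⟨
    Y + ∑[ v < n ] a g v * push u (kept t) v       ≡⟨ ∑-distrib-+ (λ v → a g v * y v) (λ v → a g v * push u (kept t) v) ⟨
    ∑[ v < n ] (a g v * y v + a g v * push u (kept t) v)
      ≡⟨ sum-cong-≗ (λ v → *-distribˡ-+ (a g v) (y v) (push u (kept t) v)) ⟨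
    ∑[ v < n ] a g v * (y v + push u (kept t) v)   ∎
    where
    open ≤-Reasoning
    Y = ∑[ v < n ] a g v * y v

  sum-removed : ∀ t → sum (removed t) ≤ sum y
  -- With `sum (kept t)` added, the left side is `m` and the right side is the size of a dominating
  -- multiset, so minimality applies.
  sum-removed t = +-cancelˡ-≤ (sum (kept t)) _ _ (begin
    sum (kept t) + sum (removed t)        ≡⟨ ∑-distrib-+ (kept t) (removed t) ⟨
    ∑[ i < m ] (kept t i + removed t i)   ≡⟨ sum-cong-≗ (kept+removed t) ⟩
    sum {m} (const 1)                     ≡⟨ trans (sum-const m 1) (*-identityʳ m) ⟩
    m                                     ≤⟨ min _ (kept-dominates t) ⟩
    ∑[ v < n ] (y v + push u (kept t) v)  ≡⟨ ∑-distrib-+ y (push u (kept t)) ⟩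
    sum y + sum (push u (kept t))         ≡⟨ cong (sum y +_) (sum-push u (kept t)) ⟩
    sum y + sum (kept t)                  ≡⟨ +-comm (sum y) _ ⟩
    sum (kept t) + sum y                  ∎)
    where open ≤-Reasoning

  -- Each of the `k` columns either keeps or removes `i`. A column that keeps `i` has a one in a row
  -- belonging to some choice `s g j = i`, and such a row has at most `x g` ones.
  deficit≤removed : ∀ i → k ≤ ∑[ g < n ] push (s g) (const (x g)) i + ∑[ t < k ] removed t i
  deficit≤removed i = begin
    k                                                     ≡⟨ trans (sum-const k 1) (*-identityʳ k) ⟨
    sum {k} (const 1)                                     ≡⟨ sum-cong-≗ {k} (λ t → kept+removed t i) ⟨
    ∑[ t < k ] (kept t i + removed t i)                   ≡⟨ ∑-distrib-+ {k} (λ t → kept t i) (λ t → removed t i) ⟩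
    ∑[ t < k ] kept t i + ∑[ t < k ] removed t i          ≤⟨ +-monoˡ-≤ _ kept≤ ⟩
    ∑[ g < n ] push (s g) (const (x g)) i + ∑[ t < k ] removed t i ∎
    where
    open ≤-Reasoning
    kept≤ : ∑[ t < k ] kept t i ≤ ∑[ g < n ] push (s g) (const (x g)) i
    kept≤ = begin
      ∑[ t < k ] kept t i      ≤⟨ sum-mono {k} (λ t → m⊓n≤m (covered t i) 1) ⟩
      ∑[ t < k ] covered t i   ≡⟨ ∑-comm (λ t g → push (s g) (λ j → circ k (x g) j t) i) ⟩
      ∑[ g < n ] ∑[ t < k ] push (s g) (λ j → circ k (x g) j t) i
        ≤⟨ sum-mono (λ g → sum-push-mono (s g) (λ t j → circ k (x g) j t) (x g)
             (λ j → ≤-trans (≤-reflexive (sum-circʳ k (x g) j)) (m⊓n≤n k (x g))) i) ⟩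
      ∑[ g < n ] push (s g) (const (x g)) i ∎

-- The double count over the product.

module Product
  (k : ℕ) .{{_ : NonZero k}} (a : Fin n → Fin n → ℕ) (b : Fin p → Fin p → ℕ)
  (b-refl : ∀ h → 1 ≤ b h h)
  (U : Vector ℕ n) (U-dom : Dominates a k U) (U-min : Minimum a k (sum U))
  (F : Fin n → Fin p → ℕ)
  (F-dom : ∀ g h → k ≤ ∑[ v < n ] a g v * F v h + ∑[ w < p ] b h w * F g w)
  where

  u : Fin (sum U) → Fin n
  u = elements U

  U-dom′ : ∀ g → k ≤ ∑[ i < sum U ] a g (u i)
  U-dom′ g = begin
    k                            ≤⟨ U-dom g ⟩
    ∑[ v < n ] a g v * U v       ≡⟨ sum-cong-≗ (λ v → *-comm (a g v) (U v)) ⟩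
    ∑[ v < n ] U v * a g v       ≡⟨ sum-elements U (a g) ⟨
    ∑[ i < sum U ] a g (u i)     ∎
    where open ≤-Reasoning

  -- Here the multiset is one of indices, `i` having multiplicity `a g (u i)`. The choice is
  -- independent of `h`, so that slices at different `h` add up in `fibre-dominates`.
  s : Fin n → Fin k → Fin (sum U)
  s g = choose (a g ∘ u) (U-dom′ g)

  module E (h : Fin p) = Exchange k a U-min u s
    (λ g → sum-choose (a g ∘ u) (U-dom′ g))
    (λ g → ∑[ w < p ] b h w * F g w) (λ v → F v h) (λ g → F-dom g h)

  -- `slice i` projects to the second factor the part of `F` over the vertices choosing `i`, once
  -- per choice; `gaps i h` counts the columns that remove `i` in the row at `h`.
  slice gaps fibre : Fin (sum U) → Vector ℕ p
  slice i h = ∑[ g < n ] push (s g) (const (F g h)) i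
  gaps  i h = ∑[ t < k ] E.removed h t i
  fibre i h = slice i h + gaps i h

  push-const-*-sum : ∀ i h g →
    push (s g) (const (∑[ w < p ] b h w * F g w)) i ≡ ∑[ w < p ] b h w * push (s g) (const (F g w)) i
  push-const-*-sum i h g = begin
    push (s g) (const (∑[ w < p ] b h w * F g w)) i
      ≡⟨ sum-cong-≗ {k} (λ j → step (does (s g j ≟ i))) ⟩
    ∑[ j < k ] ∑[ w < p ] b h w * (if does (s g j ≟ i) then F g w else 0)
      ≡⟨ ∑-comm {k} (λ j w → b h w * (if does (s g j ≟ i) then F g w else 0)) ⟩
    ∑[ w < p ] ∑[ j < k ] b h w * (if does (s g j ≟ i) then F g w else 0)
      ≡⟨ sum-cong-≗ (λ w → *-distribˡ-sum {k} (b h w) (λ j → if does (s g j ≟ i) then F g w else 0)) ⟨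
    ∑[ w < p ] b h w * push (s g) (const (F g w)) i ∎
    where
    open ≡-Reasoning
    step : ∀ c → (if c then ∑[ w < p ] b h w * F g w else 0) ≡ ∑[ w < p ] b h w * (if c then F g w else 0)
    step true  = refl
    step false = sym (trans (sum-cong-≗ (λ w → *-zeroʳ (b h w))) (trans (sum-const p 0) (*-zeroʳ p)))

  -- This is `deficit≤removed` in the row at `h`: by linearity of `push`, its first term is the
  -- weight with which `slice i` dominates `h`.
  fibre-dominates : ∀ i → Dominates b k (fibre i)
  fibre-dominates i h = begin
    k ≤⟨ E.deficit≤removed h i ⟩
    ∑[ g < n ] push (s g) (const (∑[ w < p ] b h w * F g w)) i + gaps i h
      ≤⟨ +-mono-≤ (≤-reflexive slices) gaps≤ ⟩
    ∑[ w < p ] b h w * slice i w + ∑[ w < p ] b h w * gaps i w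
      ≡⟨ ∑-distrib-+ (λ w → b h w * slice i w) (λ w → b h w * gaps i w) ⟨
    ∑[ w < p ] (b h w * slice i w + b h w * gaps i w)
      ≡⟨ sum-cong-≗ (λ w → *-distribˡ-+ (b h w) (slice i w) (gaps i w)) ⟨
    ∑[ w < p ] b h w * fibre i w ∎
    where
    open ≤-Reasoning
    slices : ∑[ g < n ] push (s g) (const (∑[ w < p ] b h w * F g w)) i ≡ ∑[ w < p ] b h w * slice i w
    slices =
      trans (sum-cong-≗ (push-const-*-sum i h))
      (trans (∑-comm (λ g w → b h w * push (s g) (const (F g w)) i))
      (sym (sum-cong-≗ (λ w → *-distribˡ-sum (b h w) (λ g → push (s g) (const (F g w)) i)))))
    -- The vertex `h` lies in its own closed neighbourhood, so the summand `w = h` is enough.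
    gaps≤ : gaps i h ≤ ∑[ w < p ] b h w * gaps i w
    gaps≤ = begin
      gaps i h                       ≡⟨ *-identityˡ (gaps i h) ⟨
      1 * gaps i h                   ≤⟨ *-monoˡ-≤ (gaps i h) (b-refl h) ⟩
      b h h * gaps i h               ≤⟨ term≤sum (λ w → b h w * gaps i w) h ⟩
      ∑[ w < p ] b h w * gaps i w    ∎

  ∣F∣ : ℕ
  ∣F∣ = ∑[ h < p ] ∑[ g < n ] F g h

  -- Each `F g h` is counted once for each of the `k` choices of `g`.
  sum-slice : ∑[ i < sum U ] sum (slice i) ≡ k * ∣F∣
  sum-slice = begin
    ∑[ i < sum U ] ∑[ h < p ] slice i h   ≡⟨ ∑-comm slice ⟩
    ∑[ h < p ] ∑[ i < sum U ] slice i h   ≡⟨ sum-cong-≗ (λ h → ∑-comm (λ i g → push (s g) (const (F g h)) i)) ⟩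
    ∑[ h < p ] ∑[ g < n ] sum (push (s g) (const (F g h)))
      ≡⟨ sum-cong-≗ (λ h → sum-cong-≗ (λ g → trans (sum-push (s g) (const (F g h))) (sum-const k (F g h)))) ⟩
    ∑[ h < p ] ∑[ g < n ] k * F g h       ≡⟨ sum-cong-≗ (λ h → *-distribˡ-sum k (λ g → F g h)) ⟨
    ∑[ h < p ] k * (∑[ g < n ] F g h)       ≡⟨ *-distribˡ-sum k (λ h → ∑[ g < n ] F g h) ⟨
    k * ∣F∣                               ∎
    where open ≡-Reasoning

  -- For each `h`, each of the `k` columns removes at most as many indices as the row at `h` has
  -- elements.
  sum-gaps : ∑[ i < sum U ] sum (gaps i) ≤ k * ∣F∣
  sum-gaps = begin
    ∑[ i < sum U ] ∑[ h < p ] gaps i h   ≡⟨ ∑-comm gaps ⟩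
    ∑[ h < p ] ∑[ i < sum U ] gaps i h   ≡⟨ sum-cong-≗ (λ h → ∑-comm (λ i t → E.removed h t i)) ⟩
    ∑[ h < p ] ∑[ t < k ] sum (E.removed h t)
      ≤⟨ sum-mono (λ h → sum-mono {k} (E.sum-removed h)) ⟩
    ∑[ h < p ] ∑[ t < k ] ∑[ g < n ] F g h   ≡⟨ sum-cong-≗ (λ h → sum-const k (∑[ g < n ] F g h)) ⟩
    ∑[ h < p ] k * (∑[ g < n ] F g h)          ≡⟨ *-distribˡ-sum k (λ h → ∑[ g < n ] F g h) ⟨
    k * ∣F∣                                  ∎
    where open ≤-Reasoning

  product-bound : Minimum b k q → sum U * q ≤ 2 * k * ∣F∣
  product-bound {q} q-min = begin
    sum U * q                                ≡⟨ sum-const (sum U) q ⟨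
    ∑[ i < sum U ] q                         ≤⟨ sum-mono (λ i → q-min (fibre i) (fibre-dominates i)) ⟩
    ∑[ i < sum U ] sum (fibre i)             ≡⟨ sum-cong-≗ (λ i → ∑-distrib-+ (slice i) (gaps i)) ⟩
    ∑[ i < sum U ] (sum (slice i) + sum (gaps i))
      ≡⟨ ∑-distrib-+ (λ i → sum (slice i)) (λ i → sum (gaps i)) ⟩
    ∑[ i < sum U ] sum (slice i) + ∑[ i < sum U ] sum (gaps i)
      ≤⟨ +-mono-≤ (≤-reflexive sum-slice) sum-gaps ⟩
    k * ∣F∣ + k * ∣F∣                        ≡⟨ cong (k * ∣F∣ +_) (+-identityʳ _) ⟨
    2 * (k * ∣F∣)                            ≡⟨ *-assoc 2 k ∣F∣ ⟨
    2 * k * ∣F∣                              ∎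
    where open ≤-Reasoning

-- Graphs as 0-1 weight matrices.

module _ (G : Graph) where
  open Graph G hiding (_≟_)

  near : Vertex → Vertex → ℕ
  near v w = if does (N[ v ]? w) then 1 else 0

  nbhd : Fin order → Fin order → ℕ
  nbhd i j = near (vertex i) (vertex j)

  near-true : ∀ {v w} → N[ v ] w → near v w ≡ 1
  near-true {v} {w} w∈N = cong (if_then 1 else 0) (dec-true (N[ v ]? w) w∈N)

  card-restrict : ∀ D v → card G (restrict G N[ v ]? D) ≡ ∑[ j < order ] near v (vertex j) * D (vertex j)
  card-restrict D v = sum-cong-≗ (λ j → step (does (N[ v ]? (vertex j))) (D (vertex j)))
    where
    step : ∀ c d → (if c then d else 0) ≡ (if c then 1 else 0) * d
    step true  d = sym (+-identityʳ d)
    step false d = refl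

  dominating⇒dominates : ∀ {D} → Dominating G k D → Dominates nbhd k (D ∘ vertex)
  dominating⇒dominates {k} {D} dom i = subst (k ≤_) (card-restrict D (vertex i)) (dom (vertex i))

  vertex-injective : ∀ {i j} → vertex i ≡ vertex j → i ≡ j
  vertex-injective = Injection.injective (↔⇒↣ (↔-sym enum))

  -- A vector on the indices becomes a multiset on the vertices by composing with `index`; both
  -- round trips of the enumeration are the identity.
  minimum : ∀ {m} → IsDominationNumber G k m → Minimum nbhd k m
  minimum {k} {m} (_ , min) D dom = subst (m ≤_) (sum-cong-≗ D-vertex) (min (D ∘ index) dom′)
    where
    D-vertex : ∀ i → D (index (vertex i)) ≡ D i
    D-vertex i = cong D (Inverse.strictlyInverseˡ enum i)
    dom′ : Dominating G k (D ∘ index)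
    dom′ v = begin
      k                                                        ≤⟨ dom (index v) ⟩
      ∑[ j < order ] near (vertex (index v)) (vertex j) * D j
        ≡⟨ sum-cong-≗ (λ j → cong₂ (λ w d → near w (vertex j) * d) (vertex-index v) (sym (D-vertex j))) ⟩
      ∑[ j < order ] near v (vertex j) * D (index (vertex j))  ≡⟨ card-restrict (D ∘ index) v ⟨
      card G (restrict G N[ v ]? (D ∘ index))                  ∎
      where open ≤-Reasoning

-- Domination in the Cartesian product.

module _ (G H : Graph) where
  private
    module G = Graph G
    module H = Graph H

  -- The enumeration of `G □ H` decodes an index by `remQuot`, which inverts `combine`.
  sum-□ : (f : G.Vertex × H.Vertex → ℕ) →
    sum (f ∘ Graph.vertex (G □ H)) ≡ ∑[ i < G.order ] ∑[ j < H.order ] f (G.vertex i , H.vertex j)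
  sum-□ f = trans (sum-combine G.order (f ∘ Graph.vertex (G □ H)))
    (sum-cong-≗ (λ i → sum-cong-≗ (λ j →
      cong (λ (i′ , j′) → f (G.vertex i′ , H.vertex j′)) (remQuot-combine i j))))

  -- A closed neighbour of a pair is one along a single factor. Equality fails only at the pair
  -- itself, which the right side counts along both factors.
  near-□ : ∀ i j i′ j′ → near (G □ H) (G.vertex i , H.vertex j) (G.vertex i′ , H.vertex j′) ≤
    (if does (j ≟ j′) then nbhd G i i′ else 0) + (if does (i ≟ i′) then nbhd H j j′ else 0)
  near-□ i j i′ j′ = bound (Graph.N[_]? (G □ H) _ _)
    where
    b₁ = if does (j ≟ j′) then nbhd G i i′ else 0
    b₂ = if does (i ≟ i′) then nbhd H j j′ else 0

    1≤b₁ : j ≡ j′ → G.N[ G.vertex i ] (G.vertex i′) → 1 ≤ b₁ + b₂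
    1≤b₁ e nb = ≤-trans
      (≤-reflexive (sym (trans (cong (if_then nbhd G i i′ else 0) (dec-true (j ≟ j′) e)) (near-true G nb))))
      (m≤m+n b₁ b₂)

    1≤b₂ : i ≡ i′ → H.N[ H.vertex j ] (H.vertex j′) → 1 ≤ b₁ + b₂
    1≤b₂ e nb = ≤-trans
      (≤-reflexive (sym (trans (cong (if_then nbhd H j j′ else 0) (dec-true (i ≟ i′) e)) (near-true H nb))))
      (m≤n+m b₂ b₁)

    bound : (d : Dec (Graph.N[_] (G □ H) (G.vertex i , H.vertex j) (G.vertex i′ , H.vertex j′))) →
      (if does d then 1 else 0) ≤ b₁ + b₂
    bound (no _)                      = z≤n
    bound (yes (inj₁ (inj₁ (e , a)))) = 1≤b₂ (vertex-injective G e) (inj₁ a)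
    bound (yes (inj₁ (inj₂ (e , a)))) = 1≤b₁ (vertex-injective H e) (inj₁ a)
    -- The pair itself is charged to the first factor.
    bound (yes (inj₂ e))              = 1≤b₁ (sym (vertex-injective H (cong proj₂ e))) (inj₂ (cong proj₁ e))

  □-dominating : ∀ {D} → Dominating (G □ H) k D →
    let F = λ i j → D (G.vertex i , H.vertex j) in
    ∀ i j → k ≤ ∑[ v < G.order ] nbhd G i v * F v j + ∑[ w < H.order ] nbhd H j w * F i w
  □-dominating {k} {D} dom i j = begin
    k ≤⟨ dom (G.vertex i , H.vertex j) ⟩
    card (G □ H) (restrict (G □ H) (Graph.N[_]? (G □ H) (G.vertex i , H.vertex j)) D)
      ≡⟨ card-restrict (G □ H) D (G.vertex i , H.vertex j) ⟩
    sum (φ ∘ Graph.vertex (G □ H))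
      ≡⟨ sum-□ φ ⟩
    ∑[ v < G.order ] ∑[ w < H.order ] φ (G.vertex v , H.vertex w)
      ≤⟨ sum-mono (λ v → sum-mono (λ w → split v w)) ⟩
    ∑[ v < G.order ] ∑[ w < H.order ] (F v w * A v w + F v w * B v w)
      ≡⟨ sum-cong-≗ (λ v → ∑-distrib-+ (λ w → F v w * A v w) (λ w → F v w * B v w)) ⟩
    ∑[ v < G.order ] (∑[ w < H.order ] F v w * A v w + ∑[ w < H.order ] F v w * B v w)
      ≡⟨ ∑-distrib-+ (λ v → ∑[ w < H.order ] F v w * A v w) (λ v → ∑[ w < H.order ] F v w * B v w) ⟩
    ∑[ v < G.order ] ∑[ w < H.order ] F v w * A v w + ∑[ v < G.order ] ∑[ w < H.order ] F v w * B v w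
      -- `A v w` vanishes unless `w = j`, and `B v w` unless `v = i`, so each double sum collapses
      -- to a single one.
      ≡⟨ cong₂ _+_
           (sum-cong-≗ (λ v → trans (sum-*-if (F v) j (nbhd G i v)) (*-comm (F v j) _)))
           (trans (∑-comm (λ v w → F v w * B v w))
             (sum-cong-≗ (λ w → trans (sum-*-if (λ v → F v w) i (nbhd H j w)) (*-comm (F i w) _)))) ⟩
    ∑[ v < G.order ] nbhd G i v * F v j + ∑[ w < H.order ] nbhd H j w * F i w ∎
    where
    open ≤-Reasoning
    F A B : Fin G.order → Fin H.order → ℕ
    F v w = D (G.vertex v , H.vertex w)
    A v w = if does (j ≟ w) then nbhd G i v else 0
    B v w = if does (i ≟ v) then nbhd H j w else 0
    φ : G.Vertex × H.Vertex → ℕ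
    φ x = near (G □ H) (G.vertex i , H.vertex j) x * D x
    split : ∀ v w → φ (G.vertex v , H.vertex w) ≤ F v w * A v w + F v w * B v w
    split v w = begin
      φ (G.vertex v , H.vertex w)    ≤⟨ *-monoˡ-≤ (F v w) (near-□ i j v w) ⟩
      (A v w + B v w) * F v w        ≡⟨ *-comm (A v w + B v w) (F v w) ⟩
      F v w * (A v w + B v w)        ≡⟨ *-distribˡ-+ (F v w) (A v w) (B v w) ⟩
      F v w * A v w + F v w * B v w  ∎

  -- Working from the defining property keeps the search behind `γ` out of the argument.
  isDominationNumber-□ : .{{_ : NonZero k}} → IsDominationNumber G k m →
    IsDominationNumber H k p → IsDominationNumber (G □ H) k q → m * p ≤ 2 * k * q
  isDominationNumber-□ {k} {p = p} isG@((U , U-dom , refl) , _) isH ((D , D-dom , refl) , _) = begin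
    card G U * p            ≤⟨ P.product-bound (minimum H isH) ⟩
    -- `P.∣F∣` sums over the second factor outermost, `card` over the first.
    2 * k * P.∣F∣           ≡⟨ cong (2 * k *_) (trans (∑-comm (λ j i → F i j)) (sym (sum-□ D))) ⟩
    2 * k * card (G □ H) D  ∎
    where
    open ≤-Reasoning
    F : Fin G.order → Fin H.order → ℕ
    F i j = D (G.vertex i , H.vertex j)
    module P = Product k (nbhd G) (nbhd H)
      (λ h → ≤-reflexive (sym (near-true H (inj₂ refl))))
      (U ∘ G.vertex) (dominating⇒dominates G {D = U} U-dom) (minimum G isG)
      F (□-dominating {D = D} D-dom)

theorem1 : (k : ℕ) → .{{_ : NonZero k}} → (G H : Graph) →
    γ k G * γ k H ≤ 2 * k * γ k (G □ H)
theorem1 k G H = isDominationNumber-□ G H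
  (γ-isDominationNumber k G) (γ-isDominationNumber k H) (γ-isDominationNumber k (G □ H))
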